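{- For every constraint list $C$ and every substitution $\sigma$: if $\mathsf{unify}(C)=\sigma$, then $(\sigma\circ\sigma)\approx\sigma$.
   Context: Types: fix a set of type variables (with decidable equality), ranged over by $\alpha,\beta,\dots$. Types are generated by $\tau ::= \alpha \mid \tau_1 \rightarrow \tau_2$. Free variables of a type (a list): $\mathsf{FTV}(\alpha) = [\alpha]$, $\mathsf{FTV}(\tau\rightarrow\tau') = \mathsf{FTV}(\tau) \mathbin{+\!\!+} \mathsf{FTV}(\tau')$, where $+\!\!+$ is list append. "$\alpha$ occurs in $\tau$" means $\alpha\in\mathsf{FTV}(\tau)$. Constraints: a constraint is a formal equation $\tau \stackrel{\rm e}{=} \tau'$ between types; a constraint list is a finite list of constraints. Substitutions: a substitution $\sigma$ is a finite map (finite partial function) from type variables to types. $\sigma_{\mathbb{E}}$ is the empty finite map and $\{\alpha\mapsto\tau\}$ the map whose only binding sends $\alpha$ to $\tau$. Application: $\sigma(\alpha)=\tau$ if $\langle\alpha,\tau\rangle\in\sigma$, $\sigma(\alpha)=\alpha$ if $\alpha$ is not bound by $\sigma$; $\sigma(\tau_1\rightarrow\tau_2)=\sigma(\tau_1)\rightarrow\sigma(\tau_2)$; $\sigma(\tau_1\stackrel{\rm e}{=}\tau_2) = (\sigma(\tau_1)\stackrel{\rm e}{=}\sigma(\tau_2))$; and $\sigma(C)$ is obtained by applying $\sigma$ to each constraint in the list $C$. Extensional equality: $\sigma\approx\sigma'$ means $\sigma(\alpha)=\sigma'(\alpha)$ for all type variables $\alpha$. Composition: $\sigma\circ\sigma'$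 is the finite map that binds $\alpha$ to $\sigma'(\tau)$ if $\langle\alpha,\tau\rangle\in\sigma$; binds $\alpha$ to $\tau'$ if $\alpha$ is not bound by $\sigma$ and $\langle\alpha,\tau'\rangle\in\sigma'$; and leaves $\alpha$ unbound otherwise. Unification: $\mathsf{unify}$ takes a constraint list and either fails ($\mathsf{None}$) or succeeds with a substitution ($\mathsf{Some}\;\sigma$); "$\mathsf{unify}(C)=\sigma$" means that it succeeds with result exactly $\sigma$. It is defined by (with $\tau$ a non-variable type in the third and fourth clauses, and failure of a recursive call propagating): (1) $\mathsf{unify}([\,]) = \sigma_{\mathbb{E}}$; (2) $\mathsf{unify}((\alpha\stackrel{\rm e}{=}\beta)::C) = \mathsf{unify}(C)$ if $\alpha=\beta$, else $\{\alpha\mapsto\beta\}\circ\mathsf{unify}(\{\alpha\mapsto\beta\}(C))$; (3) $\mathsf{unify}((\alpha\stackrel{\rm e}{=}\tau)::C)$ fails if $\alpha$ occurs in $\tau$, else is $\{\alpha\mapsto\tau\}\circ\mathsf{unify}(\{\alpha\mapsto\tau\}(C))$; (4) $\mathsf{unify}((\tau\stackrel{\rm e}{=}\alpha)::C)$ fails if $\alpha$ occurs in $\tau$, else is $\{\alpha\mapsto\tau\}\circ\mathsf{unify}(\{\alpha\mapsto\tau\}(C))$; (5) $\mathsf{unify}((\tau_1\rightarrow\tau_2\stackrel{\rm e}{=}\tau_3\rightarrow\tau_4)::C) = \mathsf{unify}((\tau_1\stackrel{\rm e}{=}\tau_3)::(\tau_2\stackrel{\rm e}{=}\tau_4)::C)$.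 This is a total function by well-founded recursion on the lexicographically ordered triple (number of distinct variables in the list, total number of arrows in the list, length of the list). -}

module Defs where

open import Data.Bool.Base using (if_then_else_)
open import Data.List.Base using (List; []; _∷_; _++_; [_]; map; concatMap; deduplicate; length)
open import Data.List.Membership.Propositional using (_∈_; _∉_)
open import Data.List.Membership.Propositional.Properties
  using (∈-++⁺ˡ; ∈-++⁺ʳ; ∈-++⁻; ∈-∃++; ∈-deduplicate⁺; ∈-deduplicate⁻)
open import Data.List.Properties using (length-++)
open import Data.List.Relation.Binary.Subset.Propositional using (_⊆_)
open import Data.List.Relation.Unary.All as All using ()
open import Data.List.Relation.Unary.All.Properties using (¬Any⇒All¬)
open import Data.List.Relation.Unary.Any using (here; there)
open import Data.List.Relation.Unary.AllPairs using ([]; _∷_)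
open import Data.List.Relation.Unary.Unique.Propositional using (Unique)
open import Data.Maybe.Base as Maybe using (Maybe; just; nothing; maybe′; fromMaybe)
open import Data.Maybe using (Is-just)
open import Data.Maybe.Relation.Unary.Any using (just)
open import Data.Nat.Base using (ℕ; suc; _+_; _≤_; _<_; z≤n; s≤s)
open import Data.Nat.ListAction using (sum)
open import Data.Nat.Induction using (<-wellFounded)
open import Data.Nat.Properties
  using (+-suc; m≤n⇒m<n∨m≡n; ≤-reflexive; ≤-trans; n<1+n; n≤1+n; module ≤-Reasoning)
open import Data.Nat.Tactic.RingSolver using (solve-∀)
open import Data.Product.Base as Product using (_×_; _,_; proj₂)
open import Data.Product.Relation.Binary.Lex.Strict using (×-Lex; ×-wellFounded)
open import Data.Sum.Base as Sum using (_⊎_; inj₁; inj₂; [_,_]′)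
open import Function.Base using (_∘_)
open import Induction.WellFounded using (Acc; acc; WellFounded; module Subrelation)
open import Level using (Level)
import Relation.Binary.Construct.On as On
open import Relation.Binary.Core using (Rel)
open import Relation.Binary.Definitions using (DecidableEquality)
open import Relation.Binary.PropositionalEquality using (_≡_; _≢_; refl; sym; cong; subst)
open import Relation.Nullary.Decidable.Core using (does; yes; no)
open import Relation.Nullary.Negation.Core using (contradiction)

module Unification {a : Level} {Var : Set a} (_≟_ : DecidableEquality Var) where

  open import Data.List.Membership.DecPropositional _≟_ using (_∈?_)
  open import Data.List.Relation.Unary.Unique.DecPropositional.Properties _≟_ using (deduplicate-!)

  infixr 7 _⇒_
  infix  5 _=ᵉ_
  infix  8 _⟨_⟩ _⟨_⟩ᶜ _⟨_⟩ˡ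
  infixr 9 _∘ₛ_
  infix  4 _≋_ _≈_ _≺_

  data Type : Set a where
    var : Var → Type
    _⇒_ : Type → Type → Type

  FTV : Type → List Var
  FTV (var α) = [ α ]
  FTV (τ ⇒ τ′) = FTV τ ++ FTV τ′

  data Constraint : Set a where
    _=ᵉ_ : Type → Type → Constraint

  Constraints : Set a
  Constraints = List Constraint

  -- Finite partial functions.  `support` may list unbound variables and may
  -- repeat entries: it only witnesses finiteness, and equality of finite maps
  -- (`_≋_`) ignores it.
  record Substitution : Set a where
    field
      lookup  : Var → Maybe Type
      support : List Var
      finite  : ∀ {α} → Is-just (lookup α) → α ∈ support

  open Substitution public

  _≋_ : Rel Substitution a
  σ ≋ σ′ = ∀ α → lookup σ α ≡ lookup σ′ α

  _⟨_⟩ : Substitution → Type → Type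
  σ ⟨ var α ⟩  = fromMaybe (var α) (lookup σ α)
  σ ⟨ τ ⇒ τ′ ⟩ = σ ⟨ τ ⟩ ⇒ σ ⟨ τ′ ⟩

  _⟨_⟩ᶜ : Substitution → Constraint → Constraint
  σ ⟨ τ =ᵉ τ′ ⟩ᶜ = σ ⟨ τ ⟩ =ᵉ σ ⟨ τ′ ⟩

  _⟨_⟩ˡ : Substitution → Constraints → Constraints
  σ ⟨ C ⟩ˡ = map (σ ⟨_⟩ᶜ) C

  _≈_ : Rel Substitution a
  σ ≈ σ′ = ∀ α → σ ⟨ var α ⟩ ≡ σ′ ⟨ var α ⟩

  ∅ : Substitution
  ∅ = record { lookup = λ _ → nothing ; support = [] ; finite = λ () }

  [_↦_] : Var → Type → Substitution
  [ α ↦ τ ] = record { lookup = bind ; support = [ α ] ; finite = fin }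
    where
    bind : Var → Maybe Type
    bind β = if does (β ≟ α) then just τ else nothing

    fin : ∀ {β} → Is-just (bind β) → β ∈ [ α ]
    fin {β} p with β ≟ α
    fin p  | yes β≡α = here β≡α
    fin () | no  _

  -- Diagrammatic order: the left-hand substitution acts first.
  _∘ₛ_ : Substitution → Substitution → Substitution
  σ ∘ₛ σ′ = record { lookup = look ; support = support σ ++ support σ′ ; finite = fin }
    where
    look : Var → Maybe Type
    look α = maybe′ (λ τ → just (σ′ ⟨ τ ⟩)) (lookup σ′ α) (lookup σ α)

    fin : ∀ {α} → Is-just (look α) → α ∈ support σ ++ support σ′
    fin {α} p with lookup σ α in eq
    ... | just τ  = ∈-++⁺ˡ (finite σ (subst Is-just (sym eq) (just _)))
    ... | nothing = ∈-++⁺ʳ (support σ) (finite σ′ p)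

  vars : Constraints → List Var
  vars = concatMap λ where (τ =ᵉ τ′) → FTV τ ++ FTV τ′

  arrows : Type → ℕ
  arrows (var _)  = 0
  arrows (τ ⇒ τ′) = suc (arrows τ + arrows τ′)

  #vars : Constraints → ℕ
  #vars C = length (deduplicate _≟_ (vars C))

  #arrows : Constraints → ℕ
  #arrows C = sum (map (λ where (τ =ᵉ τ′) → arrows τ + arrows τ′) C)

  measure : Constraints → ℕ × ℕ × ℕ
  measure C = #vars C , #arrows C , length C

  -- A record, so that the `with α ≟ β` in `unifyAcc` does not abstract over
  -- the `_≟_` inside `#vars`.
  record _≺_ (C D : Constraints) : Set where
    constructor by-measure
    field
      decreases : ×-Lex _≡_ _<_ (×-Lex _≡_ _<_ _<_) (measure C) (measure D)

  ≺-wellFounded : WellFounded _≺_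
  ≺-wellFounded = Subrelation.wellFounded _≺_.decreases
    (On.wellFounded measure
      (×-wellFounded <-wellFounded (×-wellFounded <-wellFounded <-wellFounded)))

  private

    unique-⊆⇒length-≤ : ∀ {xs ys : List Var} → Unique xs → xs ⊆ ys → length xs ≤ length ys
    unique-⊆⇒length-≤ [] _ = z≤n
    unique-⊆⇒length-≤ {x ∷ xs} (x∉ ∷ u) xs⊆ys with ∈-∃++ (xs⊆ys (here refl))
    ... | as , bs , refl = begin
      suc (length xs)               ≤⟨ s≤s (unique-⊆⇒length-≤ u sub) ⟩
      suc (length (as ++ bs))       ≡⟨ cong suc (length-++ as) ⟩
      suc (length as + length bs)   ≡⟨ +-suc (length as) (length bs) ⟨
      length as + suc (length bs)   ≡⟨ length-++ as ⟨
      length (as ++ x ∷ bs)         ∎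
      where
      open ≤-Reasoning
      sub : xs ⊆ as ++ bs
      sub y∈xs with ∈-++⁻ as (xs⊆ys (there y∈xs))
      ... | inj₁ y∈as         = ∈-++⁺ˡ y∈as
      ... | inj₂ (here refl)  = contradiction refl (All.lookup x∉ y∈xs)
      ... | inj₂ (there y∈bs) = ∈-++⁺ʳ as y∈bs

    #vars-mono : ∀ {C D} → vars C ⊆ vars D → #vars C ≤ #vars D
    #vars-mono {C} C⊆D = unique-⊆⇒length-≤ (deduplicate-! (vars C))
      (∈-deduplicate⁺ _≟_ ∘ C⊆D ∘ ∈-deduplicate⁻ _≟_ (vars C))

    #vars-strict : ∀ {C D α} → α ∉ vars C → α ∈ vars D → vars C ⊆ vars D → #vars C < #vars D
    #vars-strict {C} {D} {α} α∉C α∈D C⊆D = unique-⊆⇒length-≤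
      (¬Any⇒All¬ _ (α∉C ∘ ∈-deduplicate⁻ _≟_ (vars C)) ∷ deduplicate-! (vars C)) sub
      where
      sub : α ∷ deduplicate _≟_ (vars C) ⊆ deduplicate _≟_ (vars D)
      sub (here refl) = ∈-deduplicate⁺ _≟_ α∈D
      sub (there β∈C) = ∈-deduplicate⁺ _≟_ (C⊆D (∈-deduplicate⁻ _≟_ (vars C) β∈C))

    FTV-[↦] : ∀ {α β τ} τ′ → β ∈ FTV ([ α ↦ τ ] ⟨ τ′ ⟩) → β ∈ FTV τ ⊎ (β ≢ α × β ∈ FTV τ′)
    FTV-[↦] {α} (var γ) β∈ with γ ≟ α
    FTV-[↦] (var γ) β∈          | yes _  = inj₁ β∈
    FTV-[↦] (var γ) (here refl) | no γ≢α = inj₂ (γ≢α , here refl)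
    FTV-[↦] {α} {τ = τ} (τ₁ ⇒ τ₂) β∈ with ∈-++⁻ (FTV ([ α ↦ τ ] ⟨ τ₁ ⟩)) β∈
    ... | inj₁ β∈₁ = Sum.map₂ (Product.map₂ ∈-++⁺ˡ) (FTV-[↦] τ₁ β∈₁)
    ... | inj₂ β∈₂ = Sum.map₂ (Product.map₂ (∈-++⁺ʳ (FTV τ₁))) (FTV-[↦] τ₂ β∈₂)

    vars-[↦] : ∀ {α β τ} C → β ∈ vars ([ α ↦ τ ] ⟨ C ⟩ˡ) → β ∈ FTV τ ⊎ (β ≢ α × β ∈ vars C)
    vars-[↦] {α} {τ = τ} ((τ₁ =ᵉ τ₂) ∷ C) β∈
      with ∈-++⁻ (FTV ([ α ↦ τ ] ⟨ τ₁ ⇒ τ₂ ⟩)) β∈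
    ... | inj₁ β∈₁ = Sum.map₂ (Product.map₂ ∈-++⁺ˡ) (FTV-[↦] (τ₁ ⇒ τ₂) β∈₁)
    ... | inj₂ β∈₂ = Sum.map₂ (Product.map₂ (∈-++⁺ʳ (FTV (τ₁ ⇒ τ₂)))) (vars-[↦] C β∈₂)

    elim-≺ : ∀ {α τ} C {D} → α ∉ FTV τ → α ∈ vars D → FTV τ ⊆ vars D → vars C ⊆ vars D →
             [ α ↦ τ ] ⟨ C ⟩ˡ ≺ D
    elim-≺ {α} {τ} C {D} α∉τ α∈D τ⊆D C⊆D =
      by-measure (inj₁ (#vars-strict {[ α ↦ τ ] ⟨ C ⟩ˡ} {D} α∉ α∈D
                          ([ τ⊆D , C⊆D ∘ proj₂ ]′ ∘ vars-[↦] C)))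
      where
      α∉ : α ∉ vars ([ α ↦ τ ] ⟨ C ⟩ˡ)
      α∉ = [ α∉τ , (λ (α≢α , _) → α≢α refl) ]′ ∘ vars-[↦] C

    elimˡ-≺ : ∀ {α τ} C → α ∉ FTV τ → [ α ↦ τ ] ⟨ C ⟩ˡ ≺ (var α =ᵉ τ) ∷ C
    elimˡ-≺ {α} {τ} C α∉τ =
      elim-≺ C α∉τ (here refl) (there ∘ ∈-++⁺ˡ) (∈-++⁺ʳ (FTV (var α ⇒ τ)))

    elimʳ-≺ : ∀ {α τ} C → α ∉ FTV τ → [ α ↦ τ ] ⟨ C ⟩ˡ ≺ (τ =ᵉ var α) ∷ C
    elimʳ-≺ {α} {τ} C α∉τ =
      elim-≺ C α∉τ (∈-++⁺ˡ (∈-++⁺ʳ (FTV τ) (here refl))) (∈-++⁺ˡ ∘ ∈-++⁺ˡ) (∈-++⁺ʳ (FTV (τ ⇒ var α)))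

    tail-≺ : ∀ {α β} C → C ≺ (var α =ᵉ var β) ∷ C
    tail-≺ {α} {β} C
      with m≤n⇒m<n∨m≡n (#vars-mono {C} {(var α =ᵉ var β) ∷ C} (there ∘ there))
    ... | inj₁ lt = by-measure (inj₁ lt)
    ... | inj₂ eq = by-measure (inj₂ (eq , inj₂ (refl , n<1+n _)))

    split-≺ : ∀ {τ₁ τ₂ τ₃ τ₄} C → (τ₁ =ᵉ τ₃) ∷ (τ₂ =ᵉ τ₄) ∷ C ≺ (τ₁ ⇒ τ₂ =ᵉ τ₃ ⇒ τ₄) ∷ C
    split-≺ {τ₁} {τ₂} {τ₃} {τ₄} C
      with m≤n⇒m<n∨m≡n (#vars-mono {(τ₁ =ᵉ τ₃) ∷ (τ₂ =ᵉ τ₄) ∷ C} {(τ₁ ⇒ τ₂ =ᵉ τ₃ ⇒ τ₄) ∷ C} sub)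
      where
      sub : vars ((τ₁ =ᵉ τ₃) ∷ (τ₂ =ᵉ τ₄) ∷ C) ⊆ vars ((τ₁ ⇒ τ₂ =ᵉ τ₃ ⇒ τ₄) ∷ C)
      sub β∈ with ∈-++⁻ (FTV (τ₁ ⇒ τ₃)) β∈
      ... | inj₁ p with ∈-++⁻ (FTV τ₁) p
      ...   | inj₁ q = ∈-++⁺ˡ (∈-++⁺ˡ (∈-++⁺ˡ q))
      ...   | inj₂ q = ∈-++⁺ˡ (∈-++⁺ʳ (FTV (τ₁ ⇒ τ₂)) (∈-++⁺ˡ q))
      sub β∈ | inj₂ p with ∈-++⁻ (FTV (τ₂ ⇒ τ₄)) p
      ...   | inj₂ q = ∈-++⁺ʳ (FTV ((τ₁ ⇒ τ₂) ⇒ (τ₃ ⇒ τ₄))) q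
      ...   | inj₁ q with ∈-++⁻ (FTV τ₂) q
      ...     | inj₁ r = ∈-++⁺ˡ (∈-++⁺ˡ (∈-++⁺ʳ (FTV τ₁) r))
      ...     | inj₂ r = ∈-++⁺ˡ (∈-++⁺ʳ (FTV (τ₁ ⇒ τ₂)) (∈-++⁺ʳ (FTV τ₃) r))
    ... | inj₁ lt = by-measure (inj₁ lt)
    ... | inj₂ eq = by-measure (inj₂ (eq , inj₁ (≤-trans (n≤1+n _) (≤-reflexive
                      (lemma (arrows τ₁) (arrows τ₂) (arrows τ₃) (arrows τ₄) (#arrows C))))))
      where
      lemma : ∀ k l m n o → 2 + (k + m + (l + n + o)) ≡ suc (k + l) + suc (m + n) + o
      lemma = solve-∀

  unifyAcc : (C : Constraints) → Acc _≺_ C → Maybe Substitution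
  unifyAcc [] _ = just ∅
  unifyAcc ((var α =ᵉ var β) ∷ C) (acc rec) with α ≟ β
  ... | yes _  = unifyAcc C (rec (tail-≺ C))
  ... | no α≢β = Maybe.map ([ α ↦ var β ] ∘ₛ_)
                   (unifyAcc ([ α ↦ var β ] ⟨ C ⟩ˡ) (rec (elimˡ-≺ C λ where (here α≡β) → α≢β α≡β)))
  unifyAcc ((var α =ᵉ τ@(_ ⇒ _)) ∷ C) (acc rec) with α ∈? FTV τ
  ... | yes _  = nothing
  ... | no α∉τ = Maybe.map ([ α ↦ τ ] ∘ₛ_)
                   (unifyAcc ([ α ↦ τ ] ⟨ C ⟩ˡ) (rec (elimˡ-≺ C α∉τ)))
  unifyAcc ((τ@(_ ⇒ _) =ᵉ var α) ∷ C) (acc rec) with α ∈? FTV τ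
  ... | yes _  = nothing
  ... | no α∉τ = Maybe.map ([ α ↦ τ ] ∘ₛ_)
                   (unifyAcc ([ α ↦ τ ] ⟨ C ⟩ˡ) (rec (elimʳ-≺ C α∉τ)))
  unifyAcc ((τ₁ ⇒ τ₂ =ᵉ τ₃ ⇒ τ₄) ∷ C) (acc rec) =
    unifyAcc ((τ₁ =ᵉ τ₃) ∷ (τ₂ =ᵉ τ₄) ∷ C) (rec (split-≺ C))

  unify : Constraints → Maybe Substitution
  unify C = unifyAcc C (≺-wellFounded C)

{-# OPTIONS --safe #-}
module Submission where

-- Unification returns a substitution σ that unifies C and that every unifier θ
-- of C absorbs: θ (σ τ) = θ τ.  Taking θ = σ makes σ idempotent, with no need to
-- track which variables occur in the domain and the range of σ.

open import Defs
open import Data.List.Base using ([]; _∷_)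
open import Data.List.Membership.Propositional using (_∉_)
open import Data.List.Membership.Propositional.Properties using (∈-++⁺ˡ; ∈-++⁺ʳ)
open import Data.List.Relation.Unary.All using (All; []; _∷_)
open import Data.List.Relation.Unary.Any using (here)
open import Data.Maybe.Base using (just; nothing; fromMaybe)
open import Data.Maybe.Relation.Binary.Pointwise using (Pointwise; just)
import Data.Maybe.Relation.Unary.All as Maybe
import Data.Maybe.Relation.Unary.All.Properties as Maybe
open import Function.Base using (_∘_)
open import Induction.WellFounded using (Acc; acc)
open import Level using (Level)
open import Relation.Binary.Definitions using (DecidableEquality)
open import Relation.Binary.PropositionalEquality
  using (_≡_; refl; sym; trans; cong; cong₂; module ≡-Reasoning)
open import Relation.Nullary.Decidable.Core using (yes; no)
open import Relation.Nullary.Negation.Core using (contradiction)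

module _ {a : Level} {Var : Set a} (_≟_ : DecidableEquality Var) where

  open Unification _≟_
  open import Data.List.Membership.DecPropositional _≟_ using (_∈?_)
  open ≡-Reasoning

  ⟨⟩-cong : ∀ {σ σ′} → σ ≋ σ′ → ∀ τ → σ ⟨ τ ⟩ ≡ σ′ ⟨ τ ⟩
  ⟨⟩-cong σ≋σ′ (var α)   = cong (fromMaybe (var α)) (σ≋σ′ α)
  ⟨⟩-cong σ≋σ′ (τ₁ ⇒ τ₂) = cong₂ _⇒_ (⟨⟩-cong σ≋σ′ τ₁) (⟨⟩-cong σ≋σ′ τ₂)

  ∅-⟨⟩ : ∀ τ → ∅ ⟨ τ ⟩ ≡ τ
  ∅-⟨⟩ (var α)   = refl
  ∅-⟨⟩ (τ₁ ⇒ τ₂) = cong₂ _⇒_ (∅-⟨⟩ τ₁) (∅-⟨⟩ τ₂)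

  ∘ₛ-⟨⟩ : ∀ σ σ′ τ → (σ ∘ₛ σ′) ⟨ τ ⟩ ≡ σ′ ⟨ σ ⟨ τ ⟩ ⟩
  ∘ₛ-⟨⟩ σ σ′ (var α) with lookup σ α
  ... | just _  = refl
  ... | nothing = refl
  ∘ₛ-⟨⟩ σ σ′ (τ₁ ⇒ τ₂) = cong₂ _⇒_ (∘ₛ-⟨⟩ σ σ′ τ₁) (∘ₛ-⟨⟩ σ σ′ τ₂)

  [↦]-self : ∀ α τ → [ α ↦ τ ] ⟨ var α ⟩ ≡ τ
  [↦]-self α τ with α ≟ α
  ... | yes _  = refl
  ... | no α≢α = contradiction refl α≢α

  [↦]-fresh : ∀ {α υ} τ → α ∉ FTV τ → [ α ↦ υ ] ⟨ τ ⟩ ≡ τ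
  [↦]-fresh {α} (var β) α∉β with β ≟ α
  ... | yes β≡α = contradiction (here (sym β≡α)) α∉β
  ... | no _    = refl
  [↦]-fresh (τ₁ ⇒ τ₂) α∉τ =
    cong₂ _⇒_ ([↦]-fresh τ₁ (α∉τ ∘ ∈-++⁺ˡ)) ([↦]-fresh τ₂ (α∉τ ∘ ∈-++⁺ʳ (FTV τ₁)))

  -- The order "`σ` is at least as general as `θ`", with `θ` itself as the mediating substitution
  -- instead of an existentially quantified one. For `θ = σ` it is idempotence.
  Absorbs : Substitution → Substitution → Set a
  Absorbs θ σ = ∀ τ → θ ⟨ σ ⟨ τ ⟩ ⟩ ≡ θ ⟨ τ ⟩

  absorbs-[↦] : ∀ {θ α υ} → θ ⟨ var α ⟩ ≡ θ ⟨ υ ⟩ → Absorbs θ [ α ↦ υ ]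
  absorbs-[↦] {α = α} eq (var β) with β ≟ α
  ... | yes refl = sym eq
  ... | no _     = refl
  absorbs-[↦] eq (τ₁ ⇒ τ₂) = cong₂ _⇒_ (absorbs-[↦] eq τ₁) (absorbs-[↦] eq τ₂)

  -- An inductive family, so that matching on a proof exposes both sides of the constraint and the
  -- list can stay implicit.
  data Equates (θ : Substitution) : Constraint → Set a where
    equates : ∀ {τ τ′} → θ ⟨ τ ⟩ ≡ θ ⟨ τ′ ⟩ → Equates θ (τ =ᵉ τ′)

  Unifies : Substitution → Constraints → Set a
  Unifies θ = All (Equates θ)

  unifies-⟨⟩ˡ : ∀ {θ σ} → Absorbs θ σ → ∀ {C} → Unifies θ C → Unifies θ (σ ⟨ C ⟩ˡ)
  unifies-⟨⟩ˡ ab [] = []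
  unifies-⟨⟩ˡ ab (equates {τ} {τ′} eq ∷ eqs) =
    equates (trans (ab τ) (trans eq (sym (ab τ′)))) ∷ unifies-⟨⟩ˡ ab eqs

  unifies-∘ₛ : ∀ σ {θ C} → Unifies θ (σ ⟨ C ⟩ˡ) → Unifies (σ ∘ₛ θ) C
  -- `C` is matched explicitly: the index `σ ⟨ C ⟩ˡ` reduces only once the shape of `C` is known.
  unifies-∘ₛ σ {C = []} [] = []
  unifies-∘ₛ σ {θ} {(τ =ᵉ τ′) ∷ C} (equates eq ∷ eqs) =
    equates (trans (∘ₛ-⟨⟩ σ θ τ) (trans eq (sym (∘ₛ-⟨⟩ σ θ τ′)))) ∷ unifies-∘ₛ σ eqs

  -- The induction hypothesis. Idempotence alone is not inherited by `[ α ↦ τ ] ∘ₛ σ`; quantifying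
  -- over all unifiers lets the same `θ` be handed to the recursive call.
  record PrincipalUnifier (C : Constraints) (σ : Substitution) : Set a where
    field
      unifies  : Unifies σ C
      absorbed : ∀ {θ} → Unifies θ C → Absorbs θ σ

  open PrincipalUnifier

  -- Both fields depend on the constraints only through their set of unifiers, so rewriting a list
  -- to an equivalent one keeps `σ` principal.
  principal-resp : ∀ {C D σ} → (∀ {θ} → Unifies θ C → Unifies θ D) →
                   (∀ {θ} → Unifies θ D → Unifies θ C) →
                   PrincipalUnifier C σ → PrincipalUnifier D σ
  principal-resp C⇒D D⇒C p = record
    { unifies  = C⇒D (unifies p)
    ; absorbed = absorbed p ∘ D⇒C
    }

  principal-∅ : PrincipalUnifier [] ∅
  principal-∅ = record { unifies = [] ; absorbed = λ {θ} _ τ → cong (θ ⟨_⟩) (∅-⟨⟩ τ) }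

  principal-refl : ∀ {τ C σ} → PrincipalUnifier C σ → PrincipalUnifier ((τ =ᵉ τ) ∷ C) σ
  principal-refl = principal-resp (equates refl ∷_) λ where (_ ∷ eqs) → eqs

  -- Reduces a variable on the right of an equation to the elimination of a variable on the left.
  principal-swap : ∀ {τ τ′ C σ} → PrincipalUnifier ((τ =ᵉ τ′) ∷ C) σ →
                   PrincipalUnifier ((τ′ =ᵉ τ) ∷ C) σ
  principal-swap = principal-resp swap swap
    where
    swap : ∀ {τ τ′ C θ} → Unifies θ ((τ =ᵉ τ′) ∷ C) → Unifies θ ((τ′ =ᵉ τ) ∷ C)
    swap (equates eq ∷ eqs) = equates (sym eq) ∷ eqs

  principal-⇒ : ∀ {τ₁ τ₂ τ₃ τ₄ C σ} → PrincipalUnifier ((τ₁ =ᵉ τ₃) ∷ (τ₂ =ᵉ τ₄) ∷ C) σ →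
                PrincipalUnifier ((τ₁ ⇒ τ₂ =ᵉ τ₃ ⇒ τ₄) ∷ C) σ
  principal-⇒ = principal-resp
    (λ where (equates eq₁ ∷ equates eq₂ ∷ eqs) → equates (cong₂ _⇒_ eq₁ eq₂) ∷ eqs)
    (λ where (equates eq ∷ eqs) → equates (⇒-injˡ eq) ∷ equates (⇒-injʳ eq) ∷ eqs)
    where
    ⇒-injˡ : ∀ {τ₁ τ₂ τ₃ τ₄} → τ₁ ⇒ τ₂ ≡ τ₃ ⇒ τ₄ → τ₁ ≡ τ₃
    ⇒-injˡ refl = refl
    ⇒-injʳ : ∀ {τ₁ τ₂ τ₃ τ₄} → τ₁ ⇒ τ₂ ≡ τ₃ ⇒ τ₄ → τ₂ ≡ τ₄
    ⇒-injʳ refl = refl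

  -- A unifier `θ` of the head equation absorbs the binding. It therefore also unifies the
  -- substituted tail, so by `p` it absorbs `σ`, and the two absorptions compose.
  principal-elim : ∀ {α τ C σ} → α ∉ FTV τ → PrincipalUnifier ([ α ↦ τ ] ⟨ C ⟩ˡ) σ →
                   PrincipalUnifier ((var α =ᵉ τ) ∷ C) ([ α ↦ τ ] ∘ₛ σ)
  principal-elim {α} {τ} {C} {σ} α∉τ p = record
    { unifies  = equates solved ∷ unifies-∘ₛ [ α ↦ τ ] (unifies p)
    ; absorbed = absorbed-∘ₛ
    }
    where
    solved : ([ α ↦ τ ] ∘ₛ σ) ⟨ var α ⟩ ≡ ([ α ↦ τ ] ∘ₛ σ) ⟨ τ ⟩
    solved = begin
      ([ α ↦ τ ] ∘ₛ σ) ⟨ var α ⟩      ≡⟨ ∘ₛ-⟨⟩ [ α ↦ τ ] σ (var α) ⟩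
      σ ⟨ [ α ↦ τ ] ⟨ var α ⟩ ⟩       ≡⟨ cong (σ ⟨_⟩) ([↦]-self α τ) ⟩
      -- The occurs check enters here: the binding fixes `τ`, since `α` does not occur in it.
      σ ⟨ τ ⟩                         ≡⟨ cong (σ ⟨_⟩) ([↦]-fresh τ α∉τ) ⟨
      σ ⟨ [ α ↦ τ ] ⟨ τ ⟩ ⟩           ≡⟨ ∘ₛ-⟨⟩ [ α ↦ τ ] σ τ ⟨
      ([ α ↦ τ ] ∘ₛ σ) ⟨ τ ⟩          ∎

    absorbed-∘ₛ : ∀ {θ} → Unifies θ ((var α =ᵉ τ) ∷ C) → Absorbs θ ([ α ↦ τ ] ∘ₛ σ)
    absorbed-∘ₛ {θ} (equates eq ∷ eqs) υ = begin
      θ ⟨ ([ α ↦ τ ] ∘ₛ σ) ⟨ υ ⟩ ⟩    ≡⟨ cong (θ ⟨_⟩) (∘ₛ-⟨⟩ [ α ↦ τ ] σ υ) ⟩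
      θ ⟨ σ ⟨ [ α ↦ τ ] ⟨ υ ⟩ ⟩ ⟩     ≡⟨ absorbed p (unifies-⟨⟩ˡ ab eqs) ([ α ↦ τ ] ⟨ υ ⟩) ⟩
      θ ⟨ [ α ↦ τ ] ⟨ υ ⟩ ⟩           ≡⟨ ab υ ⟩
      θ ⟨ υ ⟩                         ∎
      where
      ab : Absorbs θ [ α ↦ τ ]
      ab = absorbs-[↦] eq

  -- Stated for every accessibility proof so that the induction mirrors the recursion of `unifyAcc`;
  -- each `rec _` is then determined by the goal. Failure holds vacuously.
  unifyAcc-principal : ∀ C (ac : Acc _≺_ C) → Maybe.All (PrincipalUnifier C) (unifyAcc C ac)
  unifyAcc-principal [] _ = Maybe.just principal-∅
  unifyAcc-principal ((var α =ᵉ var β) ∷ C) (acc rec) with α ≟ β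
  ... | yes refl = Maybe.map principal-refl (unifyAcc-principal C (rec _))
  ... | no α≢β   = Maybe.map⁺ (Maybe.map (principal-elim λ where (here α≡β) → α≢β α≡β)
                                         (unifyAcc-principal _ (rec _)))
  unifyAcc-principal ((var α =ᵉ τ@(_ ⇒ _)) ∷ C) (acc rec) with α ∈? FTV τ
  ... | yes _  = Maybe.nothing
  ... | no α∉τ = Maybe.map⁺ (Maybe.map (principal-elim α∉τ) (unifyAcc-principal _ (rec _)))
  unifyAcc-principal ((τ@(_ ⇒ _) =ᵉ var α) ∷ C) (acc rec) with α ∈? FTV τ
  ... | yes _  = Maybe.nothing
  ... | no α∉τ = Maybe.map⁺ (Maybe.map (principal-swap ∘ principal-elim α∉τ)
                                       (unifyAcc-principal _ (rec _)))
  unifyAcc-principal ((τ₁ ⇒ τ₂ =ᵉ τ₃ ⇒ τ₄) ∷ C) (acc rec) =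
    Maybe.map principal-⇒ (unifyAcc-principal _ (rec _))

  unify-principal : ∀ C → Maybe.All (PrincipalUnifier C) (unify C)
  unify-principal C = unifyAcc-principal C (≺-wellFounded C)

  -- The computed `σ′` and the given `σ` agree only as finite maps, so the claim is moved to `σ′`,
  -- proved there and moved back.
  principal-idem : ∀ {C mσ σ} → Maybe.All (PrincipalUnifier C) mσ →
                   Pointwise _≋_ mσ (just σ) → (σ ∘ₛ σ) ≈ σ
  principal-idem {σ = σ} (Maybe.just {x = σ′} p) (just σ′≋σ) α = begin
    (σ ∘ₛ σ) ⟨ var α ⟩      ≡⟨ ∘ₛ-⟨⟩ σ σ (var α) ⟩
    σ ⟨ σ ⟨ var α ⟩ ⟩       ≡⟨ ⟨⟩-cong {σ′} {σ} σ′≋σ (σ ⟨ var α ⟩) ⟨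
    σ′ ⟨ σ ⟨ var α ⟩ ⟩      ≡⟨ cong (σ′ ⟨_⟩) (⟨⟩-cong {σ′} {σ} σ′≋σ (var α)) ⟨
    -- Absorption is instantiated at `θ = σ′`, which is itself a unifier of `C`.
    σ′ ⟨ σ′ ⟨ var α ⟩ ⟩     ≡⟨ absorbed p (unifies p) (var α) ⟩
    σ′ ⟨ var α ⟩            ≡⟨ ⟨⟩-cong {σ′} {σ} σ′≋σ (var α) ⟩
    σ ⟨ var α ⟩             ∎

theorem6 : ∀ {a : Level} {Var : Set a} (_≟_ : DecidableEquality Var) →
    let open Unification _≟_ in
    (C : Constraints) (σ : Substitution) →
    Pointwise _≋_ (unify C) (just σ) → (σ ∘ₛ σ) ≈ σ
theorem6 _≟_ C σ = principal-idem _≟_ (unify-principal _≟_ C)
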